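{- Let $n$ be a positive integer, let $\lambda$ be a partition of $n$, and let $h:[n]\to\{0,1,\dots,n-1\}$ be a nondecreasing function with $h(i)<i$ for all $i\in[n]$. Let $w\in S_n$ be such that $C_w\cap\mathrm{Hess}(X_\lambda,h)\ne\emptyset$ (equivalently $R(w)\in\mathrm{RS}_h(\lambda)$) and such that $\dim(C_w\cap\mathrm{Hess}(X_\lambda,h))=|\mathrm{inv}_{\lambda,h}(w)|$ is maximal among all $w\in S_n$ for which this intersection is nonempty. Then $R(w)$ is a standard tableau.
   Context: Notation: $[n]=\{1,\dots,n\}$; $\mathbf{e}_1,\dots,\mathbf{e}_n$ is the standard basis of $\mathbb{C}^n$; $E_{ab}$ is the elementary matrix with $E_{ab}\mathbf{e}_b=\mathbf{e}_a$; permutations are identified with permutation matrices, $w\mathbf{e}_j=\mathbf{e}_{w(j)}$. $B\subset GL_n(\mathbb{C})$ is the group of upper triangular matrices. $\mathrm{Flags}(\mathbb{C}^n)\cong GL_n(\mathbb{C})/B$ is the variety of full flags $V_\bullet=(V_1\subset\cdots\subset V_n=\mathbb{C}^n)$, $\dim V_i=i$, $V_0=\{0\}$; $E_\bullet$ is the standard flag; $C_w=BwE_\bullet$ is the Schubert cell. $\mathrm{Hess}(X,h)=\{V_\bullet: X(V_i)\subseteq V_{h(i)}\ \forall i\in[n]\}$. Tableaux: the diagram of the partition $\lambda$ is left-justified with $\lambda_i$ boxes in the $i$-th row from the top. The base filling $R(e)$ labels the boxes by $1,\dots,n$, column by column from the leftmost column to the right, and from bottom to top in each column. $X_\lambda=\sum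 E_{ab}$, summed over all pairs $(a,b)$ such that $b$ labels the box directly to the right of the box labeled $a$ in $R(e)$. For $w\in S_n$, $R(w)$ is the filling of $\lambda$ in which the box labeled $i$ in $R(e)$ is labeled $w^{ -1}(i)$. $R(w)$ is $h$-strict if $\ell\le h(r)$ whenever $\ell$ labels the box directly to the left of the box labeled $r$; $\mathrm{RS}_h(\lambda)$ is the set of $h$-strict fillings. A filling is a standard tableau if entries strictly increase from left to right in rows and from top to bottom in columns. Hessenberg inversions: $(k,\ell)\in\mathrm{inv}_{\lambda,h}(w)$ iff $k>\ell$, (i) $k$ occurs in a box below $\ell$ in the same column, or in any column strictly to the left of the column containing $\ell$, in $R(w)$, and (ii) if the box directly to the right of $\ell$ in $R(w)$ exists and is labeled $r$, then $k\le h(r)$. When $R(w)\in\mathrm{RS}_h(\lambda)$, $C_w\cap\mathrm{Hess}(X_\lambda,h)$ is isomorphic to an affine space of dimension $|\mathrm{inv}_{\lambda,h}(w)|$. -}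

module Defs where

open import Algebra.Apartness.Bundles using (HeytingField; HeytingCommutativeRing)
open import Algebra.Bundles using (CommutativeRing)
import Algebra.Properties.Semiring.Sum as Sum
open import Data.Bool.Base using (if_then_else_)
open import Data.Fin.Base using (Fin; toℕ; fromℕ; fromℕ<; inject₁)
  renaming (suc to fsuc)
import Data.Fin.Properties as Fin
open import Data.Fin.Permutation using (Permutation′; _⟨$⟩ʳ_; _⟨$⟩ˡ_)
open import Data.List.Base
  using (List; []; _∷_; length; lookup; map; concatMap; filter; allFin; cartesianProduct)
open import Data.Nat.ListAction using (sum)
open import Data.List.Properties
  using (length-++; length-map; length-tabulate; map-tabulate; tabulate-lookup; filter-notAll)
open import Data.List.Membership.Propositional using (_∈_; lose)
open import Data.List.Membership.Propositional.Properties
  using (∈-map⁺; ∈-allFin; ∈-concatMap⁺)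
open import Data.List.Relation.Unary.All using (All)
open import Data.List.Relation.Unary.Linked using (Linked)
open import Data.Nat.Base using (ℕ; suc; _+_; _≤_; _<_; _≥_; _>_; NonZero)
import Data.Nat.Properties as ℕ
open import Data.Product.Base using (∃; _×_; _,_)
open import Data.Sum.Base using (_⊎_; inj₁; inj₂)
open import Data.Vec.Functional using (Vector)
open import Level using (Level; _⊔_) renaming (suc to lsuc)
open import Relation.Binary.PropositionalEquality
  using (_≡_; refl; trans; cong; cong₂; subst)
open import Relation.Nullary using (Dec; ¬_; does)
open import Relation.Nullary.Decidable using (map′; _×-dec_; _⊎-dec_; _→-dec_)
import Relation.Unary as U
open U using (Pred)

------------------------------------------------------------------------
-- Partitions, boxes, fillings

record Partition (n : ℕ) : Set where
  field
    parts         : List ℕ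
    positive      : All NonZero parts
    nonincreasing : Linked _≥_ parts
    sum≡n         : sum parts ≡ n

open Partition public

-- Rows are counted from the top and columns from the left, both from 0.

record Box {n} (lam : Partition n) : Set where
  constructor box
  field
    rowᶠ : Fin (length (parts lam))
    colᶠ : Fin (lookup (parts lam) rowᶠ)

module _ {n : ℕ} {lam : Partition n} where

  row col : Box lam → ℕ
  row (box i _) = toℕ i
  col (box _ j) = toℕ j

  -- y RightOf x : y is the box directly to the right of x.
  _RightOf_ : Box lam → Box lam → Set
  y RightOf x = row y ≡ row x × col y ≡ suc (col x)

  _rightOf?_ : ∀ y x → Dec (y RightOf x)
  y rightOf? x = (row y ℕ.≟ row x) ×-dec (col y ℕ.≟ suc (col x))

  -- The order of the boxes column by column from the left, and from bottom to
  -- top in each column.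
  _Before_ : Box lam → Box lam → Set
  y Before x = col y < col x ⊎ (col y ≡ col x × row y > row x)

  before? : ∀ x → U.Decidable (_Before x)
  before? x y =
    (col y ℕ.<? col x) ⊎-dec ((col y ℕ.≟ col x) ×-dec (row x ℕ.<? row y))

  anyBox? : ∀ {p} {P : Pred (Box lam) p} → U.Decidable P → Dec (∃ P)
  anyBox? P? = map′ (λ (i , j , p) → box i j , p) (λ (box i j , p) → i , j , p)
    (Fin.any? λ i → Fin.any? λ j → P? (box i j))

  allBox? : ∀ {p} {P : Pred (Box lam) p} → U.Decidable P → Dec (∀ x → P x)
  allBox? P? = map′ (λ f (box i j) → f i j) (λ f i j → f (box i j))
    (Fin.all? λ i → Fin.all? λ j → P? (box i j))

rowBoxes : ∀ {n} (lam : Partition n) → Fin (length (parts lam)) → List (Box lam)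
rowBoxes lam i = map (box i) (allFin (lookup (parts lam) i))

boxes : ∀ {n} (lam : Partition n) → List (Box lam)
boxes lam = concatMap (rowBoxes lam) (allFin (length (parts lam)))

∈-boxes : ∀ {n} (lam : Partition n) (x : Box lam) → x ∈ boxes lam
∈-boxes lam (box i j) =
  ∈-concatMap⁺ (rowBoxes lam) (lose (∈-allFin i) (∈-map⁺ (box i) (∈-allFin j)))

length-boxes : ∀ {n} (lam : Partition n) → length (boxes lam) ≡ n
length-boxes lam =
  trans (go (allFin (length ps)))
  (trans (cong sum (trans (map-tabulate (λ i → i) (lookup ps)) (tabulate-lookup ps)))
         (sum≡n lam))
  where
  ps = parts lam
  length-row : ∀ i → length (rowBoxes lam i) ≡ lookup ps i
  length-row i = trans (length-map (box {lam = lam} i) (allFin (lookup ps i)))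
                       (length-tabulate {n = lookup ps i} (λ j → j))
  go : ∀ is → length (concatMap (rowBoxes lam) is) ≡ sum (map (lookup ps) is)
  go []       = refl
  go (i ∷ is) = trans (length-++ (rowBoxes lam i)) (cong₂ _+_ (length-row i) (go is))

-- A label ℓ ∈ {1,…,n} is encoded as the element of Fin n with toℕ equal to ℓ - 1.

Filling : ∀ {n} → Partition n → Set
Filling {n} lam = Box lam → Fin n

label : ∀ {n} → Fin n → ℕ
label i = suc (toℕ i)

-- A box gets the label 1 + (number of boxes before it).

baseFilling : ∀ {n} (lam : Partition n) → Filling lam
baseFilling lam x = fromℕ< (subst (length (filter (before? x) (boxes lam)) <_)
  (length-boxes lam)
  (filter-notAll (before? x) (boxes lam) (lose (∈-boxes lam x) irr)))
  where
  irr : ¬ (x Before x)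
  irr (inj₁ p)       = ℕ.<-irrefl refl p
  irr (inj₂ (_ , p)) = ℕ.<-irrefl refl p

-- w ⟨$⟩ʳ j is w(j) and w ⟨$⟩ˡ i is w⁻¹(i).

R : ∀ {n} (lam : Partition n) → Permutation′ n → Filling lam
R lam w x = w ⟨$⟩ˡ baseFilling lam x

record IsStandard {n} {lam : Partition n} (T : Filling lam) : Set where
  field
    rows    : ∀ x y → row x ≡ row y → col x < col y → label (T x) < label (T y)
    columns : ∀ x y → col x ≡ col y → row x < row y → label (T x) < label (T y)

-- NextTo T a b : b labels the box directly to the right of a box labeled a.

NextTo : ∀ {n} {lam : Partition n} → Filling lam → Fin n → Fin n → Set
NextTo {lam = lam} T a b =
  ∃ λ (x : Box lam) → ∃ λ (y : Box lam) → T x ≡ a × T y ≡ b × y RightOf x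

nextTo? : ∀ {n} {lam : Partition n} (T : Filling lam) a b → Dec (NextTo T a b)
nextTo? T a b = anyBox? λ x → anyBox? λ y →
  (T x Fin.≟ a) ×-dec ((T y Fin.≟ b) ×-dec (y rightOf? x))

------------------------------------------------------------------------
-- Hessenberg inversions

-- A function h : [n] → {0,…,n-1} is given as h : Fin n → Fin n: its argument
-- is a label (shifted by one as above), its value at i is the number toℕ (h i).

module _ {n : ℕ} {lam : Partition n} where

  Inversion : (Fin n → Fin n) → Filling lam → Fin n × Fin n → Set
  Inversion h T (k , ℓ) =
    label k > label ℓ ×
    (∃ λ (x : Box lam) → ∃ λ (y : Box lam) →
      T x ≡ k × T y ≡ ℓ ×
      ((col x ≡ col y × row x > row y) ⊎ col x < col y) ×
      (∀ z → z RightOf y → label k ≤ toℕ (h (T z))))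

  inversion? : ∀ h T → U.Decidable (Inversion h T)
  inversion? h T (k , ℓ) =
    (label ℓ ℕ.<? label k) ×-dec
    (anyBox? λ x → anyBox? λ y →
      (T x Fin.≟ k) ×-dec ((T y Fin.≟ ℓ) ×-dec
      ((((col x ℕ.≟ col y) ×-dec (row y ℕ.<? row x)) ⊎-dec (col x ℕ.<? col y)) ×-dec
      (allBox? λ z → (z rightOf? y) →-dec (label k ℕ.≤? toℕ (h (T z)))))))

-- |inv_{λ,h}(w)|, the dimension of the affine space C_w ∩ Hess(X_λ,h) whenever
-- that intersection is nonempty (a known theorem, used here to read its dimension).

∣inv∣ : ∀ {n} → Partition n → (Fin n → Fin n) → Permutation′ n → ℕ
∣inv∣ {n} lam h w =
  length (filter (inversion? h (R lam w)) (cartesianProduct (allFin n) (allFin n)))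

------------------------------------------------------------------------
-- Flags, Schubert cells and Hessenberg varieties

-- The library has no complex numbers; an arbitrary Heyting field, of which ℂ is
-- an instance, takes their place.

module Geometry {c ℓ₁ ℓ₂ : Level} (F : HeytingField c ℓ₁ ℓ₂) where

  open HeytingField F
    using (Carrier; _≈_; 0#; 1#; heytingCommutativeRing)
    renaming (_+_ to _+ᶠ_; _*_ to _*ᶠ_)
  open Sum (CommutativeRing.semiring
             (HeytingCommutativeRing.commutativeRing heytingCommutativeRing))
    using () renaming (sum to ∑)

  Vec : ℕ → Set c
  Vec n = Vector Carrier n

  _≋_ : ∀ {n} → Vec n → Vec n → Set ℓ₁
  u ≋ v = ∀ i → u i ≈ v i

  Matrix : ℕ → Set c
  Matrix n = Fin n → Fin n → Carrier

  _≋ᴹ_ : ∀ {n} → Matrix n → Matrix n → Set ℓ₁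
  M ≋ᴹ N = ∀ i j → M i j ≈ N i j

  I : ∀ {n} → Matrix n
  I i j = if does (i Fin.≟ j) then 1# else 0#

  _·_ : ∀ {n} → Matrix n → Matrix n → Matrix n
  (M · N) i j = ∑ λ k → M i k *ᶠ N k j

  _·ᵛ_ : ∀ {n} → Matrix n → Vec n → Vec n
  (M ·ᵛ v) i = ∑ λ j → M i j *ᶠ v j

  Elem : ∀ {n} → Fin n → Fin n → Matrix n
  Elem a b i j = I i a *ᶠ I j b

  permMatrix : ∀ {n} → Permutation′ n → Matrix n
  permMatrix w i j = I i (w ⟨$⟩ʳ j)

  linComb : ∀ {n m} → (Fin m → Carrier) → (Fin m → Vec n) → Vec n
  linComb a v i = ∑ λ k → a k *ᶠ v k i

  Subset : ℕ → Set (c ⊔ lsuc (c ⊔ ℓ₁))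
  Subset n = Pred (Vec n) (c ⊔ ℓ₁)

  record IsSubspace {n} (S : Subset n) : Set (c ⊔ ℓ₁) where
    field
      resp     : ∀ {u v} → u ≋ v → S u → S v
      0∈       : S (λ _ → 0#)
      +-closed : ∀ {u v} → S u → S v → S (λ i → u i +ᶠ v i)
      *-closed : ∀ a {v} → S v → S (λ i → a *ᶠ v i)

  record HasDim {n} (S : Subset n) (d : ℕ) : Set (c ⊔ ℓ₁) where
    field
      basis       : Fin d → Vec n
      basis∈      : ∀ k → S (basis k)
      independent : ∀ a → linComb a basis ≋ (λ _ → 0#) → ∀ k → a k ≈ 0#
      spanning    : ∀ {v} → S v → ∃ λ a → v ≋ linComb a basis

  record Flag (n : ℕ) : Set (lsuc (c ⊔ ℓ₁)) where
    field
      V          : Fin (suc n) → Subset n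
      isSubspace : ∀ i → IsSubspace (V i)
      hasDim     : ∀ i → HasDim (V i) (toℕ i)
      nested     : ∀ (i : Fin n) → V (inject₁ i) U.⊆ V (fsuc i)
      full       : ∀ v → V (fromℕ n) v

  open Flag public

  -- E_i = span(e_1,…,e_i), i.e. the vectors whose coordinates with label
  -- greater than i vanish.
  stdFlag : ∀ {n} → Fin (suc n) → Pred (Vec n) ℓ₁
  stdFlag i v = ∀ j → label j > toℕ i → v j ≈ 0#

  image : ∀ {n} {ℓ} → Matrix n → Pred (Vec n) ℓ → Pred (Vec n) (c ⊔ ℓ₁ ⊔ ℓ)
  image M S v = ∃ λ u → S u × v ≋ (M ·ᵛ u)

  -- The group B of invertible upper triangular matrices.
  record IsBorel {n} (b : Matrix n) : Set (c ⊔ ℓ₁) where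
    field
      upper : ∀ i j → label i > label j → b i j ≈ 0#
      inv   : Matrix n
      invˡ  : (inv · b) ≋ᴹ I
      invʳ  : (b · inv) ≋ᴹ I

  Schubert : ∀ {n} → Permutation′ n → Pred (Flag n) (c ⊔ ℓ₁)
  Schubert w V• = ∃ λ b → IsBorel b ×
    (∀ i → V V• i U.≐ image (b · permMatrix w) (stdFlag i))

  -- For a label i, the space V_i is V (fsuc i), and V_{h(i)} is V (inject₁ (h i)).
  Hess : ∀ {n} → Matrix n → (Fin n → Fin n) → Pred (Flag n) (c ⊔ ℓ₁)
  Hess X h V• = ∀ i {v} → V V• (fsuc i) v → V V• (inject₁ (h i)) (X ·ᵛ v)

  -- X_λ
  nilpotent : ∀ {n} → Partition n → Matrix n
  nilpotent lam i j = ∑ λ a → ∑ λ b →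
    if does (nextTo? (baseFilling lam) a b) then Elem a b i j else 0#

{-# OPTIONS --safe #-}
-- Geometry.  If V• = b w E• lies in Hess(X_λ, h), compare leading coordinates: X_λ
-- moves the pivot of the r-th basis vector to its left neighbour ℓ, so ℓ ≤ h(r) and
-- R(w) is h-strict; conversely, if R(w) is h-strict then w E• lies in Hess(X_λ, h).
--
-- Combinatorics.  Since h(i) < i, strict fillings increase along rows. Sorting the
-- columns preserves strictness. Among the pairs k > ℓ with k in a column weakly to
-- the left of that of ℓ, those violating k ≤ h(r) for the right neighbour r of ℓ
-- correspond to the pairs (k , r) with k strictly left of r and h(r) < k, because
-- strictness gives ℓ ≤ h(r) < k. Their number is therefore unchanged by sorting,
-- while after sorting every remaining pair is an inversion. Before sorting, some
-- remaining pair is not, if the columns do not increase: take k above ℓ < k in the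
-- rightmost column that does not.
module Submission where

open import Defs
open import Algebra.Apartness.Bundles using (HeytingField; HeytingCommutativeRing)
import Algebra.Apartness.Properties.HeytingCommutativeRing as HeytingCommutativeRingProperties
open import Algebra.Bundles using (CommutativeRing)
import Algebra.Properties.Semiring.Sum as Sum
open import Data.Bool.Base using (true; false; if_then_else_)
open import Data.Empty using (⊥-elim)
open import Data.Fin.Base using (Fin; toℕ; fromℕ<; inject₁; inject≤; fromℕ; punchIn)
  renaming (zero to fzero; suc to fsuc)
import Data.Fin.Properties as Fin
open import Data.Fin.Permutation
  using (Permutation′; permutation; flip; inverseˡ; inverseʳ; _⟨$⟩ˡ_; _⟨$⟩ʳ_)
open import Data.List.Base
  using (List; _∷_; _++_; length; lookup; map; filter; allFin; cartesianProduct)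
open import Data.List.Membership.Propositional using (_∈_; _∉_)
open import Data.List.Membership.Propositional.Properties
  using (∈-lookup; ∈-allFin; ∈-map⁻; ∈-filter⁺; ∈-filter⁻; ∈-upTo⁺;
         ∈-cartesianProduct⁺; ∈-++⁺ˡ; ∈-++⁺ʳ; ∈-++⁻)
open import Data.List.Properties using (length-++; length-map; length-tabulate; length-upTo)
open import Data.List.Relation.Unary.All as All using (_∷_)
import Data.List.Relation.Unary.All.Properties as All
open import Data.List.Relation.Unary.AllPairs as AllPairs using (_∷_)
import Data.List.Relation.Unary.AllPairs.Properties as AllPairs
open import Data.List.Relation.Unary.Any as Any using (here; there)
open import Data.List.Relation.Unary.Any.Properties using (lookup-index)
open import Data.List.Relation.Unary.Sorted.TotalOrder.Properties using (lookup-mono-≤)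
open import Data.List.Relation.Unary.Unique.Propositional using (Unique)
import Data.List.Relation.Unary.Unique.Propositional.Properties as Unique
open import Data.Nat.Base using (ℕ; zero; suc; _+_; _≤_; _<_; _>_; s≤s; s≤s⁻¹; NonZero)
import Data.Nat.Properties as ℕ
open import Data.Product.Base using (∃; _×_; _,_; proj₁; proj₂)
open import Data.Sum.Base using (_⊎_; inj₁; inj₂; [_,_]′)
open import Function.Base using (_∘_; id)
open import Function.Bundles using (_↔_; mk↔ₛ′; module Inverse; module Injection)
open import Function.Construct.Composition using (_↔-∘_)
open import Function.Construct.Symmetry using (↔-sym)
open import Function.Definitions using (Injective)
open import Function.Properties.Inverse using (↔⇒↣)
open import Relation.Binary.Construct.Flip.EqAndOrd using (totalOrder)
open import Relation.Binary.Core using (REL)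
open import Relation.Binary.Definitions using (tri<; tri≈; tri>)
open import Relation.Binary.PropositionalEquality
  using (_≡_; _≢_; refl; sym; trans; cong; subst; subst₂)
import Relation.Binary.Reasoning.Setoid as SetoidReasoning
open import Relation.Nullary using (Dec; yes; no; ¬_; does; contradiction)
open import Relation.Nullary.Decidable using (_×-dec_; decidable-stable; dec-true; dec-false)
open import Relation.Unary using (Decidable; Satisfiable; _∩_)

to-injective : ∀ {a b} {A : Set a} {B : Set b} (f : A ↔ B) → Injective _≡_ _≡_ (Inverse.to f)
to-injective f = Injection.injective (↔⇒↣ f)

from-injective : ∀ {a b} {A : Set a} {B : Set b} (f : A ↔ B) → Injective _≡_ _≡_ (Inverse.from f)
from-injective f = to-injective (↔-sym f)

-- Counting by injection

lookup-injective : ∀ {a} {A : Set a} {xs : List A} → Unique xs →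
                   Injective _≡_ _≡_ (lookup xs)
lookup-injective (_  ∷ _) {fzero}  {fzero}  _  = refl
lookup-injective (x∉ ∷ _) {fzero}  {fsuc j} eq =
  contradiction eq (All.lookup x∉ (∈-lookup j))
lookup-injective (x∉ ∷ _) {fsuc i} {fzero}  eq =
  contradiction (sym eq) (All.lookup x∉ (∈-lookup i))
lookup-injective (_  ∷ u) {fsuc i} {fsuc j} eq =
  cong fsuc (lookup-injective u eq)

-- Choosing a match for every position of `xs` gives a map of positions into `ys`; it is injective
-- because a common match forces equal elements.
length-≤ : ∀ {a b r} {A : Set a} {B : Set b} (_~_ : REL A B r) {xs : List A} {ys : List B} →
           Unique xs →
           (∀ {x} → x ∈ xs → ∃ λ y → y ∈ ys × x ~ y) →
           (∀ {x x′ y} → x ~ y → x′ ~ y → x ≡ x′) →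
           length xs ≤ length ys
length-≤ _~_ {xs} {ys} uniq match inj = Fin.injective⇒≤ {f = f} f-injective
  where
  f : Fin (length xs) → Fin (length ys)
  f i = Any.index (proj₁ (proj₂ (match (∈-lookup i))))
  f-related : ∀ i → lookup xs i ~ lookup ys (f i)
  f-related i with match (∈-lookup i)
  ... | y , y∈ys , x~y = subst (lookup xs i ~_) (lookup-index y∈ys) x~y
  f-injective : Injective _≡_ _≡_ f
  f-injective {i} {j} eq = lookup-injective uniq
    (inj (f-related i) (subst (λ k → lookup xs j ~ lookup ys k) (sym eq) (f-related j)))

⊆⇒length-≤ : ∀ {a} {A : Set a} {xs ys : List A} → Unique xs →
             (∀ {x} → x ∈ xs → x ∈ ys) → length xs ≤ length ys
⊆⇒length-≤ uniq sub = length-≤ _≡_ uniq (λ x∈ → _ , sub x∈ , refl) (λ { refl refl → refl })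

∉⇒Unique : ∀ {a} {A : Set a} {x : A} {xs : List A} → x ∉ xs → Unique xs → Unique (x ∷ xs)
∉⇒Unique x∉ u = All.tabulate (λ y∈ eq → x∉ (subst (_∈ _) (sym eq) y∈)) ∷ u

-- Pigeonhole: a missing `i` could be prepended, giving `n + 1` distinct elements of `Fin n`.
Unique-full : ∀ {n} {xs : List (Fin n)} → Unique xs → length xs ≡ n → ∀ i → i ∈ xs
Unique-full {n} {xs} uniq len i with Any.any? (i Fin.≟_) xs
... | yes i∈ = i∈
... | no  i∉ = contradiction
  (subst₂ _≤_ (cong suc len) (length-tabulate {n = n} (λ j → j))
    (⊆⇒length-≤ (∉⇒Unique i∉ uniq) (λ {j} _ → ∈-allFin j)))
  ℕ.1+n≰n

injective⇒permutation : ∀ {n} (f : Fin n → Fin n) → Injective _≡_ _≡_ f →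
                        ∃ λ (π : Permutation′ n) → ∀ i → π ⟨$⟩ʳ i ≡ f i
injective⇒permutation {n} f inj =
  permutation f (λ j → proj₁ (pre j)) (λ j → proj₂ (pre j)) (λ i → inj (proj₂ (pre (f i)))) , λ _ → refl
  where
  pre : ∀ j → ∃ λ i → f i ≡ j
  pre j with ∈-map⁻ f (Unique-full (Unique.map⁺ inj (Unique.allFin⁺ n))
                        (trans (length-map f (allFin n)) (length-tabulate {n = n} (λ i → i))) j)
  ... | i , _ , eq = i , sym eq

-- Boxes

module _ {n : ℕ} {lam : Partition n} where

  row≡∧col≡⇒≡ : ∀ {x y : Box lam} → row x ≡ row y → col x ≡ col y → x ≡ y
  row≡∧col≡⇒≡ {box i j} {box i′ j′} r c with refl ← Fin.toℕ-injective r =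
    cong (box i) (Fin.toℕ-injective c)

  -- Row lengths do not increase downwards, so row `r` is at least as long as the row of `x` and
  -- reaches column `c`.
  box-at : ∀ (x : Box lam) {r c} → r ≤ row x → c ≤ col x →
           ∃ λ (y : Box lam) → row y ≡ r × col y ≡ c
  box-at (box i j) {r} {c} r≤ c≤ =
    box i′ (fromℕ< c<) , Fin.toℕ-fromℕ< r< , Fin.toℕ-fromℕ< c<
    where
    r< : r < length (parts lam)
    r< = ℕ.≤-<-trans r≤ (Fin.toℕ<n i)
    i′ = fromℕ< r<
    c< : c < lookup (parts lam) i′
    c< = ℕ.<-≤-trans (ℕ.≤-<-trans c≤ (Fin.toℕ<n j))
      (lookup-mono-≤ (totalOrder ℕ.≤-totalOrder) (nonincreasing lam)
        (subst (_≤ toℕ i) (sym (Fin.toℕ-fromℕ< r<)) r≤))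

  leftOf : ∀ (z : Box lam) {c} → col z ≡ suc c → ∃ λ y → z RightOf y × col y ≡ c
  leftOf z {c} eq with box-at z ℕ.≤-refl (ℕ.≤-trans (ℕ.n≤1+n c) (ℕ.≤-reflexive (sym eq)))
  ... | y , ry , cy = y , (sym ry , trans eq (cong suc (sym cy))) , cy

  RightOf-functional : ∀ {x y y′ : Box lam} → y RightOf x → y′ RightOf x → y ≡ y′
  RightOf-functional (r , c) (r′ , c′) = row≡∧col≡⇒≡ (trans r (sym r′)) (trans c (sym c′))

  RightOf-injective : ∀ {x x′ y : Box lam} → y RightOf x → y RightOf x′ → x ≡ x′
  RightOf-injective (r , c) (r′ , c′) =
    row≡∧col≡⇒≡ (trans (sym r) r′) (ℕ.suc-injective (trans (sym c) c′))

  before-irrefl : ∀ (x : Box lam) → ¬ (x Before x)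
  before-irrefl x (inj₁ p)       = ℕ.<-irrefl refl p
  before-irrefl x (inj₂ (_ , p)) = ℕ.<-irrefl refl p

  before-trans : ∀ (x y z : Box lam) → x Before y → y Before z → x Before z
  before-trans x y z (inj₁ p)       (inj₁ q)       = inj₁ (ℕ.<-trans p q)
  before-trans x y z (inj₁ p)       (inj₂ (e , _)) = inj₁ (ℕ.<-≤-trans p (ℕ.≤-reflexive e))
  before-trans x y z (inj₂ (e , _)) (inj₁ q)       = inj₁ (ℕ.≤-<-trans (ℕ.≤-reflexive e) q)
  before-trans x y z (inj₂ (e , p)) (inj₂ (f , q)) = inj₂ (trans e f , ℕ.<-trans q p)

  before-total : ∀ (x y : Box lam) → x ≢ y → x Before y ⊎ y Before x
  before-total x y x≢y with ℕ.<-cmp (col x) (col y)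
  ... | tri< p _ _ = inj₁ (inj₁ p)
  ... | tri> _ _ p = inj₂ (inj₁ p)
  ... | tri≈ _ c _ with ℕ.<-cmp (row x) (row y)
  ...   | tri< p _ _ = inj₂ (inj₂ (sym c , p))
  ...   | tri> _ _ p = inj₁ (inj₂ (c , p))
  ...   | tri≈ _ r _ = contradiction (row≡∧col≡⇒≡ r c) x≢y

  before-left : ∀ {x y x′ y′ : Box lam} → x′ RightOf x → y′ RightOf y →
                x′ Before y′ → x Before y
  before-left (_ , c) (_ , d) (inj₁ p) = inj₁ (s≤s⁻¹ (subst₂ _<_ c d p))
  before-left (r , c) (s , d) (inj₂ (e , p)) =
    inj₂ (ℕ.suc-injective (trans (sym c) (trans e d)) , subst₂ _<_ s r p)

Unique-boxes : ∀ {n} (lam : Partition n) → Unique (boxes lam)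
Unique-boxes lam = Unique.concat⁺
  (All.map⁺ (All.tabulate λ {i} _ →
    Unique.map⁺ (λ { refl → refl }) (Unique.allFin⁺ (lookup (parts lam) i))))
  (AllPairs.map⁺ (AllPairs.map disjoint (Unique.allFin⁺ (length (parts lam)))))
  where
  disjoint : ∀ {i i′} → i ≢ i′ → ∀ {x} → ¬ (x ∈ rowBoxes lam i × x ∈ rowBoxes lam i′)
  disjoint i≢i′ (p , q) with ∈-map⁻ _ p | ∈-map⁻ _ q
  ... | _ , _ , refl | _ , _ , refl = i≢i′ refl

-- The base filling as a bijection from boxes to labels.

module _ {n : ℕ} (lam : Partition n) where

  -- The boxes before `x`, and `x` itself as one more, are all before `y`.
  baseFilling-mono : ∀ {x y : Box lam} → x Before y → toℕ (baseFilling lam x) < toℕ (baseFilling lam y)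
  baseFilling-mono {x} {y} x<y =
    subst₂ _<_ (sym (Fin.toℕ-fromℕ< _)) (sym (Fin.toℕ-fromℕ< _))
    (⊆⇒length-≤
      (∉⇒Unique (before-irrefl x ∘ proj₂ ∘ ∈-filter⁻ (before? x) {xs = boxes lam})
                (Unique.filter⁺ (before? x) (Unique-boxes lam)))
      (λ { {z} (here refl) → ∈-filter⁺ (before? y) (∈-boxes lam x) x<y
         ; {z} (there z∈) → ∈-filter⁺ (before? y) (∈-boxes lam z)
             (before-trans z x y (proj₂ (∈-filter⁻ (before? x) {xs = boxes lam} z∈)) x<y) }))

  box≟ : (x y : Box lam) → Dec (x ≡ y)
  box≟ x y with row x ℕ.≟ row y | col x ℕ.≟ col y
  ... | yes r | yes c = yes (row≡∧col≡⇒≡ r c)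
  ... | no ¬r | _     = no (¬r ∘ cong row)
  ... | yes _ | no ¬c = no (¬c ∘ cong col)

  baseFilling-injective : Injective _≡_ _≡_ (baseFilling lam)
  baseFilling-injective {x} {y} eq with box≟ x y
  ... | yes x≡y = x≡y
  ... | no  x≢y = ⊥-elim ([ ℕ.<⇒≢ ∘ baseFilling-mono , (λ p → ℕ.<⇒≢ (baseFilling-mono p) ∘ sym) ]′
                     (before-total x y x≢y) (cong toℕ eq))

  abstract
    baseFilling-surjective : ∀ i → ∃ λ x → baseFilling lam x ≡ i
    baseFilling-surjective i
      with ∈-map⁻ (baseFilling lam)
             (Unique-full (Unique.map⁺ baseFilling-injective (Unique-boxes lam))
               (trans (length-map (baseFilling lam) (boxes lam)) (length-boxes lam)) i)
    ... | x , _ , eq = x , sym eq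

  base : Box lam ↔ Fin n
  base = mk↔ₛ′ (baseFilling lam) (proj₁ ∘ baseFilling-surjective) (proj₂ ∘ baseFilling-surjective)
    (λ x → baseFilling-injective (proj₂ (baseFilling-surjective (baseFilling lam x))))

  baseFilling-cancel-< : ∀ {x y : Box lam} → toℕ (baseFilling lam x) < toℕ (baseFilling lam y) →
                         x Before y
  baseFilling-cancel-< {x} {y} x<y with before-total x y (λ { refl → ℕ.<-irrefl refl x<y })
  ... | inj₁ p = p
  ... | inj₂ p = contradiction (baseFilling-mono p) (ℕ.<-asym x<y)

  -- The forward map is `R lam w` by definition, so results on bijective fillings apply to it as
  -- they stand.
  labelling : Permutation′ n → Box lam ↔ Fin n
  labelling w = flip w ↔-∘ base


-- Sorting the columns of a filling

HStrict : ∀ {n} {lam : Partition n} → (Fin n → Fin n) → Filling lam → Set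
HStrict {lam = lam} h T = ∀ (y z : Box lam) → z RightOf y → label (T y) ≤ toℕ (h (T z))

ColumnsIncreasing : ∀ {n} {lam : Partition n} → Filling lam → Set
ColumnsIncreasing {lam = lam} T =
  ∀ (x y : Box lam) → col x ≡ col y → row x < row y → label (T x) < label (T y)

-- Extends `∣inv∣` to arbitrary fillings; at `R lam w` the two agree by definition.
∣Inv∣ : ∀ {n} {lam : Partition n} → (Fin n → Fin n) → Filling lam → ℕ
∣Inv∣ {n} h T = length (filter (inversion? h T) (cartesianProduct (allFin n) (allFin n)))

module _ {n : ℕ} {lam : Partition n} (T : Box lam ↔ Fin n) where

  private
    module T = Inverse T

  -- "Lower" compares labels, not heights: `b` may stand above or below `a` in `T`.
  LowerInColumn : Fin n → Fin n → Set
  LowerInColumn a b = col (T.from b) ≡ col (T.from a) × toℕ b < toℕ a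

  lowerInColumn? : ∀ a → Decidable (LowerInColumn a)
  lowerInColumn? a b = (col (T.from b) ℕ.≟ col (T.from a)) ×-dec (toℕ b ℕ.<? toℕ a)

  lowerInColumn : Fin n → List (Fin n)
  lowerInColumn a = filter (lowerInColumn? a) (allFin n)

  -- The row, counted from 0, that `a` occupies once its column is sorted.
  rank : Fin n → ℕ
  rank a = length (lowerInColumn a)

  Unique-∷lowerInColumn : ∀ a → Unique (a ∷ lowerInColumn a)
  Unique-∷lowerInColumn a =
    ∉⇒Unique (ℕ.<-irrefl refl ∘ proj₂ ∘ proj₂ ∘ ∈-filter⁻ (lowerInColumn? a) {xs = allFin n})
             (Unique.filter⁺ (lowerInColumn? a) (Unique.allFin⁺ n))

  ∈-∷lowerInColumn⁻ : ∀ a {b} → b ∈ a ∷ lowerInColumn a →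
                      col (T.from b) ≡ col (T.from a) × toℕ b ≤ toℕ a
  ∈-∷lowerInColumn⁻ a (here refl) = refl , ℕ.≤-refl
  ∈-∷lowerInColumn⁻ a (there b∈) with ∈-filter⁻ (lowerInColumn? a) {xs = allFin n} b∈
  ... | _ , c , b<a = c , ℕ.<⇒≤ b<a

  rank-mono-< : ∀ {a b} → col (T.from a) ≡ col (T.from b) → toℕ a < toℕ b → rank a < rank b
  rank-mono-< {a} {b} c a<b = ⊆⇒length-≤ (Unique-∷lowerInColumn a) λ {d} d∈ →
    let (e , d≤a) = ∈-∷lowerInColumn⁻ a d∈ in
    ∈-filter⁺ (lowerInColumn? b) (∈-allFin d) (trans e c , ℕ.≤-<-trans d≤a a<b)

  -- Otherwise the column of `a`, having no gaps above its boxes, would only have rows of index less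
  -- than `rank a`, while `a` and the smaller entries of its column occupy `rank a + 1` distinct
  -- rows.
  rank-box : ∀ a → ∃ λ (x : Box lam) → row x ≡ rank a × col x ≡ col (T.from a)
  rank-box a with anyBox? (λ x → (row x ℕ.≟ rank a) ×-dec (col x ℕ.≟ col (T.from a)))
  ... | yes p = p
  ... | no ¬p = contradiction
    (subst (suc (rank a) ≤_) (length-upTo (rank a))
      (length-≤ (λ b r → row (T.from b) ≡ r × col (T.from b) ≡ col (T.from a))
        (Unique-∷lowerInColumn a)
        (λ {b} b∈ → let (c , _) = ∈-∷lowerInColumn⁻ a b∈ in
          row (T.from b) , ∈-upTo⁺ (row< b c) , refl , c)
        (λ { (r , c) (r′ , c′) →
             from-injective T (row≡∧col≡⇒≡ (trans r (sym r′)) (trans c (sym c′))) })))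
    ℕ.1+n≰n
    where
    row< : ∀ b → col (T.from b) ≡ col (T.from a) → row (T.from b) < rank a
    row< b c with row (T.from b) ℕ.<? rank a
    ... | yes r< = r<
    ... | no  r≮ with box-at (T.from b) (ℕ.≮⇒≥ r≮) ℕ.≤-refl
    ...   | x , r , c′ = contradiction (x , r , trans c′ c) ¬p

  place : Fin n → Box lam
  place a = proj₁ (rank-box a)

  place-injective : Injective _≡_ _≡_ place
  place-injective {a} {b} eq with ℕ.<-cmp (toℕ a) (toℕ b) | rank-box a | rank-box b
  ... | tri≈ _ a≡b _ | _ | _ = Fin.toℕ-injective a≡b
  ... | tri< a<b _ _ | x , r , c | y , r′ , c′ with refl ← eq =
    contradiction (trans (sym r) r′) (ℕ.<⇒≢ (rank-mono-< (trans (sym c) c′) a<b))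
  ... | tri> _ _ b<a | x , r , c | y , r′ , c′ with refl ← eq =
    contradiction (trans (sym r′) r) (ℕ.<⇒≢ (rank-mono-< (trans (sym c′) c) b<a))

  abstract
    -- In R(v) the label `a` stands in the box with base label v(a), so this `v` puts `a` into
    -- `place a`.
    sorting : ∃ λ (v : Permutation′ n) → ∀ a → v ⟨$⟩ʳ a ≡ baseFilling lam (place a)
    sorting = injective⇒permutation (baseFilling lam ∘ place)
                                    (place-injective ∘ baseFilling-injective lam)

  sorted : Box lam ↔ Fin n
  sorted = labelling lam (proj₁ sorting)

  place-sorted : ∀ x → place (Inverse.to sorted x) ≡ x
  place-sorted x = baseFilling-injective lam
    (trans (sym (proj₂ sorting _)) (inverseʳ (proj₁ sorting)))

  row-sorted : ∀ x → row x ≡ rank (Inverse.to sorted x)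
  row-sorted x = trans (cong row (sym (place-sorted x))) (proj₁ (proj₂ (rank-box _)))

  col-sorted : ∀ x → col x ≡ col (T.from (Inverse.to sorted x))
  col-sorted x = trans (cong col (sym (place-sorted x))) (proj₂ (proj₂ (rank-box _)))

  -- The sorted filling enters the arguments below only through these two equations: columns keep
  -- their labels, and the row of a label is its rank.
  module _ (S : Box lam ↔ Fin n)
           (row-S : ∀ x → row x ≡ rank (Inverse.to S x))
           (col-S : ∀ x → col x ≡ col (T.from (Inverse.to S x))) where

    private
      module S = Inverse S

    col-from : ∀ a → col (S.from a) ≡ col (T.from a)
    col-from a = trans (col-S (S.from a)) (cong (col ∘ T.from) (S.strictlyInverseˡ a))

    -- Ranks grow strictly with the labels of a column, so a smaller label further down would
    -- contradict `row-S`.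
    rank-rows⇒increasing : ColumnsIncreasing {lam = lam} S.to
    rank-rows⇒increasing x y c r<
      with ℕ.<-cmp (toℕ (S.to x)) (toℕ (S.to y))
    ... | tri< p _ _ = s≤s p
    ... | tri≈ _ p _ = contradiction
      (trans (row-S x) (trans (cong rank (Fin.toℕ-injective p)) (sym (row-S y)))) (ℕ.<⇒≢ r<)
    ... | tri> _ _ p = contradiction
      (subst₂ _<_ (sym (row-S y)) (sym (row-S x))
        (rank-mono-< (trans (sym (col-S y)) (trans (sym c) (col-S x))) p))
      (ℕ.<-asym r<)

    module _ {h : Fin n → Fin n} (h-mono : ∀ i j → label i ≤ label j → toℕ (h i) ≤ toℕ (h j))
             (T-strict : HStrict {lam = lam} h T.to) where

      -- Were the i-th entry ℓ of a column larger than h(r), for r the i-th entry of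
      -- the next column, then the left neighbours in T of the i smallest entries of
      -- that next column would be i entries smaller than ℓ.
      rank-rows⇒strict : HStrict {lam = lam} h S.to
      rank-rows⇒strict y z (r , c) = decidable-stable (_ ℕ.≤? _) λ ℓ≰ →
        ℕ.<⇒≢ (rank-< (ℕ.≰⇒> ℓ≰))
          (trans (sym (row-S z)) (trans r (row-S y)))
        where
        rank-< : toℕ (h (S.to z)) < label (S.to y) → rank (S.to z) < rank (S.to y)
        -- Entries are matched with their left neighbours in `T`. Counting `S.to z` itself along
        -- with the smaller entries makes the inequality strict, whereas `y` and `z` share a row and
        -- so have equal ranks.
        rank-< hz<y = length-≤ (λ b d → T.from b RightOf T.from d)
          (Unique-∷lowerInColumn (S.to z)) match
          (λ {_} {_} {d} p q → from-injective T (RightOf-functional {x = T.from d} p q))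
          where
          match : ∀ {b} → b ∈ S.to z ∷ lowerInColumn (S.to z) →
                  ∃ λ d → d ∈ lowerInColumn (S.to y) × T.from b RightOf T.from d
          match {b} b∈ with ∈-∷lowerInColumn⁻ (S.to z) b∈
          ... | e , b≤z with leftOf (T.from b) (trans e (trans (sym (col-S z)) c))
          ...   | x , bx , cx = T.to x ,
            ∈-filter⁺ (lowerInColumn? (S.to y)) (∈-allFin (T.to x))
              ( trans (cong col (T.strictlyInverseʳ x)) (trans cx (col-S y))
              , s≤s⁻¹ (ℕ.≤-<-trans (T-strict x (T.from b) bx)
                  (ℕ.≤-<-trans (h-mono _ _ (s≤s (subst (λ a → toℕ a ≤ toℕ (S.to z)) (sym (T.strictlyInverseˡ b)) b≤z)))
                               hz<y))) ,
            subst (T.from b RightOf_) (sym (T.strictlyInverseʳ x)) bx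

-- Comparing the numbers of inversions

module _ {n : ℕ} {lam : Partition n} (h : Fin n → Fin n) where

  Pair : Set
  Pair = Fin n × Fin n

  pairs : List Pair
  pairs = cartesianProduct (allFin n) (allFin n)

  ∈-pairs : ∀ p → p ∈ pairs
  ∈-pairs (k , ℓ) = ∈-cartesianProduct⁺ (∈-allFin k) (∈-allFin ℓ)

  Unique-pairs : Unique pairs
  Unique-pairs = Unique.cartesianProduct⁺ (Unique.allFin⁺ n) (Unique.allFin⁺ n)

  module _ (T : Box lam ↔ Fin n) where

    private
      module T = Inverse T

    WeaklyLeft : Pair → Set
    WeaklyLeft (k , ℓ) = label ℓ < label k × col (T.from k) ≤ col (T.from ℓ)

    weaklyLeft? : Decidable WeaklyLeft
    weaklyLeft? (k , ℓ) = (label ℓ ℕ.<? label k) ×-dec (col (T.from k) ℕ.≤? col (T.from ℓ))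

    -- Failure of inversion condition (ii) in positive form, exhibiting the right neighbour of `ℓ`.
    Blocked : Pair → Set
    Blocked (k , ℓ) = WeaklyLeft (k , ℓ) ×
      ∃ λ (z : Box lam) → z RightOf T.from ℓ × toℕ (h (T.to z)) < label k

    blocked? : Decidable Blocked
    blocked? (k , ℓ) = weaklyLeft? (k , ℓ) ×-dec
      anyBox? (λ z → (z rightOf? T.from ℓ) ×-dec (toℕ (h (T.to z)) ℕ.<? label k))

    inversion⇒weaklyLeft : ∀ {p} → Inversion {lam = lam} h T.to p → WeaklyLeft p
    inversion⇒weaklyLeft (k>ℓ , x , y , refl , refl , pos , _) = k>ℓ ,
      subst₂ (λ u v → col u ≤ col v) (sym (T.strictlyInverseʳ x)) (sym (T.strictlyInverseʳ y))
        ([ ℕ.≤-reflexive ∘ proj₁ , ℕ.<⇒≤ ]′ pos)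

    inversion⇒¬blocked : ∀ {p} → Inversion {lam = lam} h T.to p → ¬ Blocked p
    inversion⇒¬blocked (_ , x , y , refl , refl , _ , free) (_ , z , zy , h<k) =
      ℕ.<⇒≱ h<k (free z (subst (z RightOf_) (T.strictlyInverseʳ y) zy))

    weaklyLeft⇒inversion : ColumnsIncreasing {lam = lam} T.to → ∀ {p} → WeaklyLeft p → ¬ Blocked p →
                           Inversion {lam = lam} h T.to p
    weaklyLeft⇒inversion incr {k , ℓ} wl@(k>ℓ , c) ¬bl =
      k>ℓ , T.from k , T.from ℓ , T.strictlyInverseˡ k , T.strictlyInverseˡ ℓ , pos (ℕ.m≤n⇒m<n∨m≡n c) ,
      λ z zℓ → ℕ.≮⇒≥ (λ h<k → ¬bl (wl , z , zℓ , h<k))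
      where
      pos : col (T.from k) < col (T.from ℓ) ⊎ col (T.from k) ≡ col (T.from ℓ) →
            (col (T.from k) ≡ col (T.from ℓ) × row (T.from k) > row (T.from ℓ)) ⊎
            col (T.from k) < col (T.from ℓ)
      pos (inj₁ c<) = inj₂ c<
      -- Weakly left differs from condition (i) only for two labels of one column; there the larger
      -- one stands lower, as columns increase.
      pos (inj₂ c≡) with ℕ.<-cmp (row (T.from k)) (row (T.from ℓ))
      ... | tri> _ _ r> = inj₁ (c≡ , r>)
      ... | tri≈ _ r≡ _ = contradiction
        (from-injective T (row≡∧col≡⇒≡ r≡ c≡))
        (ℕ.<⇒≢ k>ℓ ∘ cong label ∘ sym)
      ... | tri< r< _ _ = contradiction
        (subst₂ (λ a b → label a < label b) (T.strictlyInverseˡ k) (T.strictlyInverseˡ ℓ)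
          (incr (T.from k) (T.from ℓ) c≡ r<))
        (ℕ.<-asym k>ℓ)

  module _ (T S : Box lam ↔ Fin n) where

    private
      module T = Inverse T
      module S = Inverse S

    module _ (same-col : ∀ a → col (S.from a) ≡ col (T.from a))
             (T-strict : HStrict {lam = lam} h T.to) where

      -- A blocked pair (k , ℓ) is determined by k and the right neighbour r of ℓ, and
      -- which pairs (k , r) occur depends only on the columns: strictness gives
      -- ℓ ≤ h(r) < k for any left neighbour ℓ of r.
      blocked-≤ : length (filter (blocked? S) pairs) ≤ length (filter (blocked? T) pairs)
      blocked-≤ = length-≤ _~_ (Unique.filter⁺ (blocked? S) Unique-pairs) match inj
        where
        _~_ : Pair → Pair → Set
        (k , ℓ) ~ (k′ , ℓ′) =
          k ≡ k′ × ∃ λ r → S.from r RightOf S.from ℓ × T.from r RightOf T.from ℓ′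

        match : ∀ {p} → p ∈ filter (blocked? S) pairs →
                ∃ λ q → q ∈ filter (blocked? T) pairs × p ~ q
        match {k , ℓ} p∈ with ∈-filter⁻ (blocked? S) {xs = pairs} p∈
        ... | _ , (k>ℓ , c≤) , z , zℓ , h<k
          -- The label `r` has the same column in `T` as in `S`, just right of that of `ℓ`, so it
          -- has a left neighbour in `T` too.
          with leftOf (T.from (S.to z)) {col (S.from ℓ)}
                 (trans (sym (same-col (S.to z))) (trans (cong col (S.strictlyInverseʳ z)) (proj₂ zℓ)))
        ...   | y , zy , cy = (k , T.to y) ,
          ∈-filter⁺ (blocked? T) (∈-pairs _)
            ( ( ℕ.≤-<-trans (T-strict y (T.from r) zy)
                  (subst (λ a → toℕ (h a) < label k) (sym (T.strictlyInverseˡ r)) h<k)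
              , subst₂ _≤_ (same-col k) (trans (sym cy) (cong col (sym (T.strictlyInverseʳ y)))) c≤)
            , T.from r , zy′ , subst (λ a → toℕ (h a) < label k) (sym (T.strictlyInverseˡ r)) h<k) ,
          refl , r , subst (_RightOf S.from ℓ) (sym (S.strictlyInverseʳ z)) zℓ , zy′
          where
          r = S.to z
          zy′ : T.from r RightOf T.from (T.to y)
          zy′ = subst (T.from r RightOf_) (sym (T.strictlyInverseʳ y)) zy

        inj : ∀ {p q s} → p ~ s → q ~ s → p ≡ q
        -- The right neighbour of `ℓ′` in `T` determines `r`, and the left neighbour of `r` in `S`
        -- determines `ℓ`.
        inj {k , ℓ} {_ , m} {_ , ℓ′} (refl , r , rℓ , r′) (refl , t , tm , t′) =
          cong (k ,_) (from-injective S
            (RightOf-injective {y = S.from r} rℓ (subst (λ a → S.from a RightOf S.from m) (sym r≡t) tm)))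
          where
          r≡t : r ≡ t
          r≡t = from-injective T (RightOf-functional {x = T.from ℓ′} r′ t′)

      -- `T` and `S` have the same weakly left pairs. For `T`, inversions and blocked pairs are
      -- disjoint and both miss `p`; for `S`, they exhaust these pairs. As `S` has at most as many
      -- blocked pairs, it has more inversions.
      ∣Inv∣-< : ColumnsIncreasing {lam = lam} S.to →
                ∀ {p} → WeaklyLeft T p → ¬ Blocked T p → ¬ Inversion {lam = lam} h T.to p →
                ∣Inv∣ {lam = lam} h T.to < ∣Inv∣ {lam = lam} h S.to
      ∣Inv∣-< incr {p} wl ¬bl ¬inv = ℕ.+-cancelʳ-< (length bT) (length iT) (length iS) (begin-strict
        length iT + length bT           <⟨ ℕ.n<1+n _ ⟩
        suc (length iT + length bT)     ≡⟨ cong suc (sym (length-++ iT)) ⟩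
        length (p ∷ iT ++ bT)           ≤⟨ ⊆⇒length-≤ unique lower ⟩
        length wT                       ≤⟨ ⊆⇒length-≤ (Unique.filter⁺ (weaklyLeft? T) Unique-pairs) upper ⟩
        length (iS ++ bS)               ≡⟨ length-++ iS ⟩
        length iS + length bS           ≤⟨ ℕ.+-monoʳ-≤ (length iS) blocked-≤ ⟩
        length iS + length bT           ∎)
        where
        open ℕ.≤-Reasoning
        iT = filter (inversion? {lam = lam} h T.to) pairs
        iS = filter (inversion? {lam = lam} h S.to) pairs
        bT = filter (blocked? T) pairs
        bS = filter (blocked? S) pairs
        wT = filter (weaklyLeft? T) pairs

        ∈-iT⁻ : ∀ {q} → q ∈ iT → Inversion {lam = lam} h T.to q
        ∈-iT⁻ = proj₂ ∘ ∈-filter⁻ (inversion? {lam = lam} h T.to) {xs = pairs}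

        ∈-bT⁻ : ∀ {q} → q ∈ bT → Blocked T q
        ∈-bT⁻ = proj₂ ∘ ∈-filter⁻ (blocked? T) {xs = pairs}

        unique : Unique (p ∷ iT ++ bT)
        unique = ∉⇒Unique (λ p∈ → [ ¬inv ∘ ∈-iT⁻ , ¬bl ∘ ∈-bT⁻ ]′ (∈-++⁻ iT p∈))
          (Unique.++⁺ (Unique.filter⁺ (inversion? {lam = lam} h T.to) Unique-pairs)
                      (Unique.filter⁺ (blocked? T) Unique-pairs)
                      (λ (i , b) → inversion⇒¬blocked T (∈-iT⁻ i) (∈-bT⁻ b)))

        lower : ∀ {q} → q ∈ p ∷ iT ++ bT → q ∈ wT
        lower {q} (here refl) = ∈-filter⁺ (weaklyLeft? T) (∈-pairs q) wl
        lower {q} (there q∈) = ∈-filter⁺ (weaklyLeft? T) (∈-pairs q)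
          ([ inversion⇒weaklyLeft T ∘ ∈-iT⁻ , proj₁ ∘ ∈-bT⁻ ]′ (∈-++⁻ iT q∈))

        upper : ∀ {q} → q ∈ wT → q ∈ iS ++ bS
        upper {q@(k , ℓ)} q∈ with ∈-filter⁻ (weaklyLeft? T) {xs = pairs} q∈ | blocked? S q
        ... | _ | yes bl = ∈-++⁺ʳ iS (∈-filter⁺ (blocked? S) (∈-pairs q) bl)
        ... | _ , k>ℓ , c | no ¬bl = ∈-++⁺ˡ (∈-filter⁺ (inversion? {lam = lam} h S.to) (∈-pairs q)
          (weaklyLeft⇒inversion S incr (k>ℓ , subst₂ _≤_ (sym (same-col k)) (sym (same-col ℓ)) c) ¬bl))

-- If T has a column descent, one in the rightmost possible column is an inversion
-- gained by sorting.
maximal⇒columnsIncreasing :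
  ∀ {n} {lam : Partition n} {h : Fin n → Fin n} →
  (∀ i j → label i ≤ label j → toℕ (h i) ≤ toℕ (h j)) →
  (T S : Box lam ↔ Fin n) →
  (∀ x → row x ≡ rank T (Inverse.to S x)) →
  (∀ x → col x ≡ col (Inverse.from T (Inverse.to S x))) →
  HStrict {lam = lam} h (Inverse.to T) →
  ∣Inv∣ {lam = lam} h (Inverse.to S) ≤ ∣Inv∣ {lam = lam} h (Inverse.to T) →
  ColumnsIncreasing {lam = lam} (Inverse.to T)
maximal⇒columnsIncreasing {n} {lam} {h} h-mono T S row-S col-S strict maximal x y =
  go (lookup (parts lam) (Box.rowᶠ y)) x y (ℕ.m≤m+n _ _)
  where
  module T = Inverse T
  -- Induction from right to left: the row of `y` has at most `f` boxes from `y` on. This excludes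
  -- `f` = 0, and a right neighbour of `y` satisfies the bound with one less.
  go : ∀ f (x y : Box lam) → lookup (parts lam) (Box.rowᶠ y) ≤ f + col y →
       col x ≡ col y → row x < row y → label (T.to x) < label (T.to y)
  go zero x (box i j) le c r< = contradiction (Fin.toℕ<n j) (ℕ.≤⇒≯ le)
  go (suc f) x y le c r< with ℕ.<-cmp (toℕ (T.to x)) (toℕ (T.to y))
  ... | tri< p _ _ = s≤s p
  ... | tri≈ _ p _ = contradiction
    (cong row (to-injective T (Fin.toℕ-injective p))) (ℕ.<⇒≢ r<)
  ... | tri> _ _ p = contradiction maximal (ℕ.<⇒≱
    (∣Inv∣-< h T S (col-from T S row-S col-S) strict (rank-rows⇒increasing T S row-S col-S) wl ¬bl ¬inv))
    where
    wl : WeaklyLeft h T (T.to x , T.to y)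
    wl = s≤s p , ℕ.≤-reflexive (trans (cong col (T.strictlyInverseʳ x))
           (trans c (cong col (sym (T.strictlyInverseʳ y)))))

    ¬inv : ¬ Inversion {lam = lam} h T.to (T.to x , T.to y)
    ¬inv (_ , x′ , y′ , ex , ey , pos , _) with refl ← to-injective T ex | refl ← to-injective T ey =
      [ ℕ.<-asym r< ∘ proj₂ , ℕ.<-irrefl c ]′ pos

    ¬bl : ¬ Blocked h T (T.to x , T.to y)
    -- The box `z′` above `z` in the row of `x` is the right neighbour of `x`. Hence T(x) ≤ h(T(z′))
    -- ≤ h(T(z)), the column of `z` being increasing by induction.
    ¬bl (_ , z , zy , h<) with subst (z RightOf_) (T.strictlyInverseʳ y) zy
    ... | r , cz with box-at z (ℕ.≤-trans (ℕ.<⇒≤ r<) (ℕ.≤-reflexive (sym r))) (ℕ.≤-refl {col z})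
    ...   | z′ , r′ , c′ = ℕ.<⇒≱ h< (ℕ.≤-trans
      (strict x z′ (r′ , trans c′ (trans cz (cong suc (sym c)))))
      (h-mono _ _ (ℕ.<⇒≤ (go f z′ z le′ c′ (subst₂ _<_ (sym r′) (sym r) r<)))))
      where
      le′ : lookup (parts lam) (Box.rowᶠ z) ≤ f + col z
      le′ = subst₂ _≤_ (cong (lookup (parts lam)) (sym (Fin.toℕ-injective r)))
        (trans (sym (ℕ.+-suc f (col y))) (cong (f +_) (sym cz))) le

-- Horizontal neighbours ℓ, r satisfy ℓ ≤ h(r) < r; induction on the column of `y` chains these
-- steps.
strict⇒rowsIncreasing :
  ∀ {n} {lam : Partition n} {h : Fin n → Fin n} {T : Filling lam} →
  (∀ i → toℕ (h i) < label i) → HStrict h T →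
  ∀ x y → row x ≡ row y → col x < col y → label (T x) < label (T y)
strict⇒rowsIncreasing {lam = lam} {h} {T} h<id strict x y = go (col y) y refl
  where
  go : ∀ c (y : Box lam) → col y ≡ c → row x ≡ row y → col x < c → label (T x) < label (T y)
  go (suc c) y cy r x<y with leftOf y cy
  ... | z , yz , cz with ℕ.m≤n⇒m<n∨m≡n (s≤s⁻¹ x<y)
  ...   | inj₁ x<z = ℕ.<-trans (go c z cz (trans r (proj₁ yz)) x<z)
                                (ℕ.≤-<-trans (strict z y yz) (h<id (T y)))
  ...   | inj₂ x≡z with refl ← row≡∧col≡⇒≡ {x = x} {z} (trans r (proj₁ yz)) (trans x≡z (sym cz)) =
    ℕ.≤-<-trans (strict x y yz) (h<id (T y))

-- Linear algebra

module LinearAlgebra {c ℓ₁ ℓ₂} (F : HeytingField c ℓ₁ ℓ₂) where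

  open Geometry F
  private
    H = HeytingField.heytingCommutativeRing F
  open CommutativeRing (HeytingCommutativeRing.commutativeRing H)
    using (Carrier; _≈_; 0#; 1#; setoid; semiring; reflexive; +-cong; +-congˡ; +-identityˡ; +-identityʳ;
           *-cong; *-congˡ; *-congʳ; *-assoc; *-comm; *-identityˡ; *-identityʳ; zeroˡ; zeroʳ)
    renaming (refl to ≈-refl; sym to ≈-sym; trans to ≈-trans; _+_ to _⊕_; _*_ to _⊛_)
  open Sum semiring
    using (sum-cong-≋; sum-replicate-zero; sum-remove; ∑-comm; *-distribˡ-sum; *-distribʳ-sum)
    renaming (sum to ∑)
  open SetoidReasoning setoid

  *-zeroʳ-≈ : ∀ {x y} → y ≈ 0# → x ⊛ y ≈ 0#
  *-zeroʳ-≈ {x} y≈0 = ≈-trans (*-congˡ y≈0) (zeroʳ x)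

  *-zeroˡ-≈ : ∀ {x y} → x ≈ 0# → x ⊛ y ≈ 0#
  *-zeroˡ-≈ {_} {y} x≈0 = ≈-trans (*-congʳ x≈0) (zeroˡ y)

  sum-zero : ∀ {n} {f : Vec n} → (∀ j → f j ≈ 0#) → ∑ f ≈ 0#
  sum-zero {n} f≈0 = ≈-trans (sum-cong-≋ f≈0) (sum-replicate-zero n)

  sum-single : ∀ {n} {f : Vec n} i → (∀ j → j ≢ i → f j ≈ 0#) → ∑ f ≈ f i
  sum-single {suc n} {f} i f≈0 = begin
    ∑ f                            ≈⟨ sum-remove {i = i} f ⟩
    f i ⊕ ∑ (λ j → f (punchIn i j)) ≈⟨ +-congˡ (sum-zero λ j → f≈0 (punchIn i j) (Fin.punchInᵢ≢i i j)) ⟩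
    f i ⊕ 0#                       ≈⟨ +-identityʳ (f i) ⟩
    f i                            ∎

  if-yes : ∀ {p} {P : Set p} (d : Dec P) {x y : Carrier} → P → (if does d then x else y) ≈ x
  if-yes d p rewrite dec-true d p = ≈-refl

  if-no : ∀ {p} {P : Set p} (d : Dec P) {x y : Carrier} → ¬ P → (if does d then x else y) ≈ y
  if-no d ¬p rewrite dec-false d ¬p = ≈-refl

  I-≡ : ∀ {n} {i j : Fin n} → i ≡ j → I i j ≈ 1#
  I-≡ {i = i} {j} = if-yes (i Fin.≟ j)

  I-≢ : ∀ {n} {i j : Fin n} → i ≢ j → I i j ≈ 0#
  I-≢ {i = i} {j} = if-no (i Fin.≟ j)

  I-cancel : ∀ {n} {i j : Fin n} {x} → i ≡ j → x ⊛ I i j ≈ x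
  I-cancel eq = ≈-trans (*-congˡ (I-≡ eq)) (*-identityʳ _)

  I-cancelˡ : ∀ {n} {i j : Fin n} {x} → i ≡ j → I i j ⊛ x ≈ x
  I-cancelˡ eq = ≈-trans (*-congʳ (I-≡ eq)) (*-identityˡ _)

  ·-identityˡ : ∀ {n} (M : Matrix n) → (I · M) ≋ᴹ M
  ·-identityˡ M i j = ≈-trans
    (sum-single i λ k k≢i → *-zeroˡ-≈ (I-≢ (k≢i ∘ sym)))
    (I-cancelˡ {i = i} refl)

  I·ᵛ : ∀ {n} (v : Vec n) → (I ·ᵛ v) ≋ v
  I·ᵛ v i = ≈-trans
    (sum-single i λ k k≢i → *-zeroˡ-≈ (I-≢ (k≢i ∘ sym)))
    (I-cancelˡ {i = i} refl)

  ·ᵛ-congˡ : ∀ {n} (M : Matrix n) {u v : Vec n} → u ≋ v → (M ·ᵛ u) ≋ (M ·ᵛ v)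
  ·ᵛ-congˡ M u≋v i = sum-cong-≋ λ j → *-congˡ (u≋v j)

  ·ᵛ-congʳ : ∀ {n} {M N : Matrix n} (v : Vec n) → M ≋ᴹ N → (M ·ᵛ v) ≋ (N ·ᵛ v)
  ·ᵛ-congʳ v M≋N i = sum-cong-≋ λ j → *-congʳ (M≋N i j)

  ·ᵛ-assoc : ∀ {n} (M N : Matrix n) (v : Vec n) → ((M · N) ·ᵛ v) ≋ (M ·ᵛ (N ·ᵛ v))
  ·ᵛ-assoc M N v i = begin
    ∑ (λ j → ∑ (λ k → M i k ⊛ N k j) ⊛ v j)     ≈⟨ sum-cong-≋ (λ j → *-distribʳ-sum (v j) (λ k → M i k ⊛ N k j)) ⟩
    ∑ (λ j → ∑ (λ k → (M i k ⊛ N k j) ⊛ v j))   ≈⟨ ∑-comm (λ j k → (M i k ⊛ N k j) ⊛ v j) ⟩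
    ∑ (λ k → ∑ (λ j → (M i k ⊛ N k j) ⊛ v j))   ≈⟨ sum-cong-≋ (λ k → sum-cong-≋ λ j → *-assoc (M i k) (N k j) (v j)) ⟩
    ∑ (λ k → ∑ (λ j → M i k ⊛ (N k j ⊛ v j)))   ≈⟨ sum-cong-≋ (λ k → *-distribˡ-sum (M i k) (λ j → N k j ⊛ v j)) ⟨
    ∑ (λ k → M i k ⊛ ∑ (λ j → N k j ⊛ v j))     ∎

  permMatrix-·ᵛ : ∀ {n} (w : Permutation′ n) (u : Vec n) → (permMatrix w ·ᵛ u) ≋ (λ i → u (w ⟨$⟩ˡ i))
  permMatrix-·ᵛ w u i = ≈-trans
    (sum-single (w ⟨$⟩ˡ i) λ j j≢ → *-zeroˡ-≈ (I-≢ λ eq → j≢ (trans (sym (inverseˡ w)) (cong (w ⟨$⟩ˡ_) (sym eq)))))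
    (I-cancelˡ {i = i} (sym (inverseʳ w)))

  ·permMatrix-·ᵛ : ∀ {n} (M : Matrix n) (w : Permutation′ n) (u : Vec n) →
                   ((M · permMatrix w) ·ᵛ u) ≋ (M ·ᵛ (λ i → u (w ⟨$⟩ˡ i)))
  ·permMatrix-·ᵛ M w u i = ≈-trans (·ᵛ-assoc M (permMatrix w) u i) (·ᵛ-congˡ M (permMatrix-·ᵛ w u) i)

  -- Inverses of upper triangular matrices.

  module _ {n} {b : Matrix n} (isBorel : IsBorel b) where

    open IsBorel isBorel

    private
      -- Of the sum for entry (i, j) of `inv · b`, the terms with k < j vanish by assumption and
      -- those with k > j because `b` is upper triangular.
      entry : ∀ i j → toℕ j ≤ toℕ i → (∀ k → toℕ k < toℕ j → inv i k ≈ 0#) → inv i j ⊛ b j j ≈ I i j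
      entry i j j≤i below = ≈-trans (≈-sym (sum-single j off)) (invˡ i j)
        where
        off : ∀ k → k ≢ j → inv i k ⊛ b k j ≈ 0#
        off k k≢j with ℕ.<-cmp (toℕ k) (toℕ j)
        ... | tri< k<j _ _ = *-zeroˡ-≈ (below k k<j)
        ... | tri≈ _ k≡j _ = contradiction (Fin.toℕ-injective k≡j) k≢j
        ... | tri> _ _ j<k = *-zeroʳ-≈ (upper k j (s≤s j<k))

      -- Induction on a bound `m` for the column: with the earlier columns known, `entry` gives
      -- `inv i j ⊛ b j j ≈ 0#`, and multiplying by `inv j j` cancels `b j j`.
      upper-below : ∀ m i j → toℕ j < m → toℕ j < toℕ i → inv i j ≈ 0#
      upper-below (suc m) i j j<m j<i = begin
        inv i j                     ≈⟨ *-identityʳ (inv i j) ⟨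
        inv i j ⊛ 1#                ≈⟨ *-congˡ (≈-trans (*-comm (b j j) (inv j j)) diag) ⟨
        inv i j ⊛ (b j j ⊛ inv j j) ≈⟨ *-assoc (inv i j) (b j j) (inv j j) ⟨
        (inv i j ⊛ b j j) ⊛ inv j j ≈⟨ *-zeroˡ-≈ (≈-trans (entry i j (ℕ.<⇒≤ j<i) (below i (ℕ.<⇒≤ j<i)))
                                                          (I-≢ {i = i} {j} λ { refl → ℕ.<-irrefl refl j<i })) ⟩
        0#                          ∎
        where
        below : ∀ i → toℕ j ≤ toℕ i → ∀ k → toℕ k < toℕ j → inv i k ≈ 0#
        below i j≤i k k<j = upper-below m i k (ℕ.<-≤-trans k<j (s≤s⁻¹ j<m)) (ℕ.<-≤-trans k<j j≤i)
        diag : inv j j ⊛ b j j ≈ 1#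
        diag = ≈-trans (entry j j ℕ.≤-refl (below j ℕ.≤-refl)) (I-≡ {i = j} refl)

    inv-upper : ∀ i j → toℕ j < toℕ i → inv i j ≈ 0#
    inv-upper i j = upper-below (suc (toℕ j)) i j ℕ.≤-refl

    inv-diagonal : ∀ j → inv j j ⊛ b j j ≈ 1#
    inv-diagonal j = ≈-trans (entry j j ℕ.≤-refl (λ k → inv-upper j k)) (I-≡ {i = j} refl)

    -- Lets membership in a space of the flag b w E• be tested on b⁻¹x, whose coordinates are those
    -- of the preimage `u` permuted by `w`.
    inv-image : ∀ (w : Permutation′ n) {u x : Vec n} → x ≋ ((b · permMatrix w) ·ᵛ u) →
                (inv ·ᵛ x) ≋ (λ i → u (w ⟨$⟩ˡ i))
    inv-image w {u} {x} eq i = begin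
      (inv ·ᵛ x) i             ≈⟨ ·ᵛ-congˡ inv (λ j → ≈-trans (eq j) (·permMatrix-·ᵛ b w u j)) i ⟩
      (inv ·ᵛ (b ·ᵛ u′)) i     ≈⟨ ·ᵛ-assoc inv b u′ i ⟨
      ((inv · b) ·ᵛ u′) i      ≈⟨ ·ᵛ-congʳ u′ invˡ i ⟩
      (I ·ᵛ u′) i              ≈⟨ I·ᵛ u′ i ⟩
      u′ i                     ∎
      where
      u′ : Vec n
      u′ j = u (w ⟨$⟩ˡ j)

  I-isBorel : ∀ {n} → IsBorel (I {n})
  I-isBorel = record
    { upper = λ i j i>j → I-≢ {i = i} {j} λ { refl → ℕ.<-irrefl refl i>j }
    ; inv   = I
    ; invˡ  = ·-identityˡ I
    ; invʳ  = ·-identityˡ I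
    }

  -- The matrix X_λ, and strictness from a nonempty intersection.

  module _ {n} (lam : Partition n) where

    private
      Next : Fin n → Fin n → Set
      Next = NextTo (baseFilling lam)

      term : Fin n → Fin n → Fin n → Fin n → Carrier
      term i j a b = if does (nextTo? (baseFilling lam) a b) then Elem a b i j else 0#

      term-0 : ∀ {i j a b} → Elem a b i j ≈ 0# → term i j a b ≈ 0#
      term-0 {a = a} {b} e≈0 with does (nextTo? (baseFilling lam) a b)
      ... | true  = e≈0
      ... | false = ≈-refl

      -- `Elem a b` vanishes away from entry (a, b), so only a = i, b = j survives in the double
      -- sum.
      nilpotent-term : ∀ i j → nilpotent lam i j ≈ term i j i j
      nilpotent-term i j = ≈-trans
        (sum-single {f = λ a → ∑ (term i j a)} i λ a a≢i →
          sum-zero λ b → term-0 {i} {j} {a} {b} (*-zeroˡ-≈ (I-≢ (a≢i ∘ sym))))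
        (sum-single {f = term i j i} j λ b b≢j → term-0 {i} {j} {i} {b} (*-zeroʳ-≈ (I-≢ (b≢j ∘ sym))))

    nilpotent-1 : ∀ {i j} → Next i j → nilpotent lam i j ≈ 1#
    nilpotent-1 {i} {j} next = begin
      nilpotent lam i j ≈⟨ nilpotent-term i j ⟩
      term i j i j      ≈⟨ if-yes (nextTo? (baseFilling lam) i j) next ⟩
      I i i ⊛ I j j     ≈⟨ I-cancel {i = j} refl ⟩
      I i i             ≈⟨ I-≡ {i = i} refl ⟩
      1#                ∎

    nilpotent-0 : ∀ {i j} → ¬ Next i j → nilpotent lam i j ≈ 0#
    nilpotent-0 {i} {j} ¬next =
      ≈-trans (nilpotent-term i j) (if-no (nextTo? (baseFilling lam) i j) ¬next)

    -- The nonzero entry of column b e_q, q = w(r), in row q is moved by X_λ to row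
    -- p = w(ℓ), where it is the lowest one, as taking left neighbours preserves the
    -- order of the base filling. So b⁻¹ X_λ b e_q has a nonzero p-th entry, which
    -- forces ℓ ≤ h(r).
    nonempty⇒strict : ∀ (h : Fin n → Fin n) (w : Permutation′ n) →
                      Satisfiable (Schubert w ∩ Hess (nilpotent lam) h) →
                      HStrict {lam = lam} h (R lam w)
    nonempty⇒strict h w (V• , (b , isBorel , cell) , hess) y z zy =
      decidable-stable (_ ℕ.≤? _) λ ≰ → HeytingField.#-irrefl F (1≈0 (ℕ.≰⇒> ≰))
        (HeytingCommutativeRingProperties.1#0 H)
      where
      open IsBorel isBorel
      X = nilpotent lam
      p = baseFilling lam y
      q = baseFilling lam z
      r = R lam w z
      col-q : Vec n
      col-q i = b i q

      col-q∈ : V V• (fsuc r) col-q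
      col-q∈ = proj₂ (cell (fsuc r))
        -- The preimage is e_r: since w(r) = q, b w e_r = b e_q.
        ( (λ j → I j r)
        , (λ j j>r → I-≢ {i = j} {r} λ { refl → ℕ.<-irrefl refl j>r })
        , λ i → ≈-sym (≈-trans (·permMatrix-·ᵛ b w (λ j → I j r) i)
            (≈-trans (sum-single q λ k k≢q → *-zeroʳ-≈ (I-≢ (k≢q ∘ from-injective w)))
                     (I-cancel {i = r} refl))))

      X-below : ∀ j → toℕ p < toℕ j → (X ·ᵛ col-q) j ≈ 0#
      -- Column `q` of `b` vanishes after row `q`, and for m ≤ q the left neighbour of `m`, if any,
      -- has base label at most `p`, hence is not `j`.
      X-below j p<j = sum-zero λ m → case-≤ m (toℕ m ℕ.≤? toℕ q)
        where
        case-≤ : ∀ m → Dec (toℕ m ≤ toℕ q) → X j m ⊛ b m q ≈ 0#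
        case-≤ m (no  m≰q) = *-zeroʳ-≈ (upper m q (s≤s (ℕ.≰⇒> m≰q)))
        case-≤ m (yes m≤q) = *-zeroˡ-≈ (nilpotent-0 not-next)
          where
          not-next : ¬ Next j m
          not-next (y′ , z′ , refl , refl , z′y′) with ℕ.m≤n⇒m<n∨m≡n m≤q
          ... | inj₁ m<q = ℕ.<-asym p<j (baseFilling-mono lam
            (before-left {x = y′} {y} {z′} {z} z′y′ zy (baseFilling-cancel-< lam {z′} {z} m<q)))
          ... | inj₂ m≡q with refl ← baseFilling-injective lam {z′} {z} (Fin.toℕ-injective m≡q)
                         with refl ← RightOf-injective {x = y} {y′} zy z′y′ = ℕ.<-irrefl refl p<j

      X-at : (X ·ᵛ col-q) p ≈ b q q
      X-at = ≈-trans (sum-single q λ m m≢q → *-zeroˡ-≈ (nilpotent-0 (not-next m≢q)))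
        (≈-trans (*-congʳ (nilpotent-1 (y , z , refl , refl , zy))) (*-identityˡ (b q q)))
        where
        not-next : ∀ {m} → m ≢ q → ¬ Next p m
        not-next m≢q (y′ , z′ , y′≡ , refl , z′y′)
          with refl ← baseFilling-injective lam {y′} {y} y′≡ =
          m≢q (cong (baseFilling lam) (RightOf-functional {x = y} z′y′ zy))

      inv-X-at : (inv ·ᵛ (X ·ᵛ col-q)) p ≈ inv p p ⊛ b q q
      -- Row `p` of `inv` vanishes before position `p`, and X b e_q vanishes after it.
      inv-X-at = ≈-trans (sum-single p off) (*-congˡ X-at)
        where
        off : ∀ j → j ≢ p → inv p j ⊛ (X ·ᵛ col-q) j ≈ 0#
        off j j≢p with ℕ.<-cmp (toℕ j) (toℕ p)
        ... | tri< j<p _ _ = *-zeroˡ-≈ (inv-upper isBorel p j j<p)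
        ... | tri≈ _ j≡p _ = contradiction (Fin.toℕ-injective j≡p) j≢p
        ... | tri> _ _ p<j = *-zeroʳ-≈ (X-below j p<j)

      1≈0 : toℕ (h r) < label (R lam w y) → 1# ≈ 0#
      -- If ℓ > h(r), then `u` vanishes at ℓ, so `inv p p ⊛ b q q` is zero. Both factors are units,
      -- with inverses `b p p` and `inv q q`.
      1≈0 h<ℓ with proj₁ (cell (inject₁ (h r))) (hess r col-q∈)
      ... | u , u∈ , eq = begin
        1#                                       ≈⟨ *-identityˡ 1# ⟨
        1# ⊛ 1#                                  ≈⟨ *-cong (inv-diagonal isBorel q) (inv-diagonal isBorel p) ⟨
        (inv q q ⊛ b q q) ⊛ (inv p p ⊛ b p p)    ≈⟨ *-assoc (inv q q) (b q q) _ ⟩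
        inv q q ⊛ (b q q ⊛ (inv p p ⊛ b p p))    ≈⟨ *-congˡ (*-assoc (b q q) (inv p p) (b p p)) ⟨
        inv q q ⊛ ((b q q ⊛ inv p p) ⊛ b p p)    ≈⟨ *-zeroʳ-≈ (*-zeroˡ-≈ (begin
          b q q ⊛ inv p p                          ≈⟨ *-comm (b q q) (inv p p) ⟩
          inv p p ⊛ b q q                          ≈⟨ inv-X-at ⟨
          (inv ·ᵛ (X ·ᵛ col-q)) p                  ≈⟨ inv-image isBorel w eq p ⟩
          u (R lam w y)                            ≈⟨ u∈ _ (subst (_< label (R lam w y)) (sym (Fin.toℕ-inject₁ (h r))) h<ℓ) ⟩
          0#                                       ∎)) ⟩
        0#                                       ∎

  -- Coordinate flags

  module _ {n} (w : Permutation′ n) where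

    -- The span of e_w(1), ..., e_w(i), given by vanishing coordinates so that closure and the
    -- action of X_λ are checked entry by entry.
    Coordinate : Fin (suc n) → Vec n → Set ℓ₁
    Coordinate i x = ∀ j → label j > toℕ i → x (w ⟨$⟩ʳ j) ≈ 0#

    private
      -- The factor `I` is the Borel element required by `Schubert`, so the flag lies in the cell of
      -- `w` by identity inclusions.
      M = I · permMatrix w

      M-·ᵛ : ∀ u → (M ·ᵛ u) ≋ (λ i → u (w ⟨$⟩ˡ i))
      M-·ᵛ u i = ≈-trans (·permMatrix-·ᵛ I w u i) (I·ᵛ _ i)

    image⇒coordinate : ∀ i {x} → image M (stdFlag i) x → Coordinate i x
    image⇒coordinate i {x} (u , u∈ , eq) j j>i = begin
      x (w ⟨$⟩ʳ j)            ≈⟨ eq _ ⟩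
      (M ·ᵛ u) (w ⟨$⟩ʳ j)     ≈⟨ M-·ᵛ u _ ⟩
      u (w ⟨$⟩ˡ (w ⟨$⟩ʳ j))   ≈⟨ reflexive (cong u (inverseˡ w)) ⟩
      u j                     ≈⟨ u∈ j j>i ⟩
      0#                      ∎

    coordinate⇒image : ∀ i {x} → Coordinate i x → image M (stdFlag i) x
    coordinate⇒image i {x} x∈ = (λ j → x (w ⟨$⟩ʳ j)) , x∈ , λ k →
      ≈-trans (reflexive (cong x (sym (inverseʳ w)))) (≈-sym (M-·ᵛ _ k))

    coordinateFlag : Flag n
    coordinateFlag = record
      { V          = λ i → image M (stdFlag i)
      ; isSubspace = λ i → record
        { resp     = λ { u≋v (a , a∈ , eq) → a , a∈ , λ k → ≈-trans (≈-sym (u≋v k)) (eq k) }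
        ; 0∈       = coordinate⇒image i λ _ _ → ≈-refl
        ; +-closed = λ u∈ v∈ → coordinate⇒image i λ j j>i → ≈-trans
            (+-cong (image⇒coordinate i u∈ j j>i) (image⇒coordinate i v∈ j j>i)) (+-identityˡ 0#)
        ; *-closed = λ a v∈ → coordinate⇒image i λ j j>i → *-zeroʳ-≈ (image⇒coordinate i v∈ j j>i)
        }
      ; hasDim     = dim
      ; nested     = λ i (u , u∈ , eq) → u ,
          (λ j j>i → u∈ j (subst (_< label j) (sym (Fin.toℕ-inject₁ i)) (ℕ.<-trans (ℕ.n<1+n _) j>i))) , eq
      ; full       = λ v → coordinate⇒image (fromℕ n) λ j j>n → contradiction
          (subst (_< label j) (Fin.toℕ-fromℕ n) j>n) (ℕ.≤⇒≯ (Fin.toℕ<n j))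
      }
      where
      dim : ∀ i → HasDim (image M (stdFlag i)) (toℕ i)
      dim i = record
        { basis       = basis
        ; basis∈      = λ k → coordinate⇒image i λ j j>i → I-≢ λ eq → ℕ.<⇒≱ j>i
            (subst (λ m → suc m ≤ toℕ i) (sym (trans (cong toℕ (to-injective w eq)) (Fin.toℕ-inject≤ k _)))
              (Fin.toℕ<n k))
        ; independent = λ a eq k → ≈-trans
            (≈-sym (≈-trans (sum-single k λ k′ k′≢k → *-zeroʳ-≈
                              (I-≢ (k′≢k ∘ sym ∘ Fin.inject≤-injective _ _ k k′ ∘ to-injective w)))
                            (I-cancel {i = ι k} refl)))
            (eq (ι k))
        ; spanning    = λ {v} v∈ → (λ k → v (ι k)) , λ m → expand v (image⇒coordinate i v∈) m (toℕ (w ⟨$⟩ˡ m) ℕ.<? toℕ i)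
        }
        where
        ι : Fin (toℕ i) → Fin n
        ι k = w ⟨$⟩ʳ inject≤ k (Fin.toℕ≤pred[n] i)

        basis : Fin (toℕ i) → Vec n
        basis k m = I m (ι k)

        expand : ∀ v → Coordinate i v → ∀ m → Dec (toℕ (w ⟨$⟩ˡ m) < toℕ i) →
                 v m ≈ linComb (λ k → v (ι k)) basis m
        expand v v∈ m (yes j<i) = ≈-sym (≈-trans
          (sum-single k λ k′ k′≢k → *-zeroʳ-≈ (I-≢ λ eq → k′≢k
            (Fin.inject≤-injective _ _ k′ k (to-injective w (trans (sym eq) (sym ιk≡m))))))
          (≈-trans (I-cancel (sym ιk≡m)) (reflexive (cong v ιk≡m))))
          where
          k = fromℕ< j<i
          ιk≡m : ι k ≡ m
          ιk≡m = trans (cong (w ⟨$⟩ʳ_) (Fin.toℕ-injective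
            (trans (Fin.toℕ-inject≤ k _) (Fin.toℕ-fromℕ< j<i)))) (inverseʳ w)
        expand v v∈ m (no j≮i) = ≈-trans
          (≈-trans (reflexive (cong v (sym (inverseʳ w)))) (v∈ (w ⟨$⟩ˡ m) (s≤s (ℕ.≮⇒≥ j≮i))))
          (≈-sym (sum-zero λ k → *-zeroʳ-≈ (I-≢ {i = m} {ι k} λ { refl → j≮i (subst (_< toℕ i)
            (sym (trans (cong toℕ (inverseˡ w)) (Fin.toℕ-inject≤ k _))) (Fin.toℕ<n k)) })))

    -- The flag w E• serves: X_λ moves coordinate w(r), r ≤ i, to w(j) for the left neighbour j of r
    -- in R(w), if there is one, and j ≤ h(r) ≤ h(i).
    strict⇒nonempty : ∀ {lam : Partition n} {h : Fin n → Fin n} →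
                      (∀ i j → label i ≤ label j → toℕ (h i) ≤ toℕ (h j)) →
                      HStrict {lam = lam} h (R lam w) →
                      Satisfiable (Schubert w ∩ Hess (nilpotent lam) h)
    strict⇒nonempty {lam} {h} h-mono strict =
      coordinateFlag , (I , I-isBorel , λ _ → id , id) , hess
      where
      X = nilpotent lam
      hess : Hess X h coordinateFlag
      hess i {x} x∈ = coordinate⇒image (inject₁ (h i)) λ j j>h →
        sum-zero λ m → vanish j m (subst (_< label j) (Fin.toℕ-inject₁ (h i)) j>h)
                         (nextTo? (baseFilling lam) (w ⟨$⟩ʳ j) m)
        where
        vanish : ∀ j m → toℕ (h i) < label j → Dec (NextTo (baseFilling lam) (w ⟨$⟩ʳ j) m) →
                 X (w ⟨$⟩ʳ j) m ⊛ x m ≈ 0#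
        vanish j m h<j (no ¬next) = *-zeroˡ-≈ (nilpotent-0 lam ¬next)
        vanish j _ h<j (yes (y , z , y≡ , refl , zy)) = *-zeroʳ-≈ (≈-trans
          (reflexive (cong x (sym (inverseʳ w))))
          (image⇒coordinate (fsuc i) x∈ (R lam w z) (ℕ.≰⇒> λ r≤i → ℕ.<⇒≱ h<j (ℕ.≤-trans
            (subst (λ a → label a ≤ toℕ (h (R lam w z))) (trans (cong (w ⟨$⟩ˡ_) y≡) (inverseˡ w)) (strict y z zy))
            (h-mono _ _ r≤i)))))

theorem6p3 : ∀ {c ℓ₁ ℓ₂} (F : HeytingField c ℓ₁ ℓ₂) →
    let open Geometry F in
    (n : ℕ) → .{{_ : NonZero n}} →
    (lam : Partition n) →
    (h : Fin n → Fin n) →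
    (∀ i → toℕ (h i) < label i) →
    (∀ i j → label i ≤ label j → toℕ (h i) ≤ toℕ (h j)) →
    (w : Permutation′ n) →
    Satisfiable (Schubert w ∩ Hess (nilpotent lam) h) →
    (∀ v → Satisfiable (Schubert v ∩ Hess (nilpotent lam) h) → ∣inv∣ lam h v ≤ ∣inv∣ lam h w) →
    IsStandard (R lam w)
theorem6p3 F n lam h h<id h-mono w nonempty maximal = record
  { rows    = strict⇒rowsIncreasing h<id strict
  ; columns = maximal⇒columnsIncreasing h-mono T (sorted T) (row-sorted T) (col-sorted T) strict
      -- The competitor `v` is the permutation whose filling sorts the columns of R(w). Sorting
      -- keeps strictness, so its cell meets the Hessenberg variety.
      (maximal v (strict⇒nonempty v {lam} h-mono
        (rank-rows⇒strict T (sorted T) (row-sorted T) (col-sorted T) h-mono strict)))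
  }
  where
  open LinearAlgebra F
  T = labelling lam w
  v = proj₁ (sorting T)
  strict : HStrict {lam = lam} h (R lam w)
  strict = nonempty⇒strict lam h w nonempty
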